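{- The Diophantine equation $X^4+Y^4=2Z^4$ has infinitely many solutions in $M_2(\mathbb{Z})$; that is, the set of triples $(X,Y,Z)\in M_2(\mathbb{Z})^3$ with $X^4+Y^4=2Z^4$ is infinite.
   Context: $M_n(\mathbb{Z})$ denotes the ring of $n\times n$ matrices with integer entries; powers are taken with respect to matrix multiplication. -}

module Defs where

open import Algebra.Bundles.Raw using (RawRing)
import Algebra.Definitions.RawSemiring as SemiringDefinitions
open import Data.Bool.Base using (if_then_else_)
open import Data.Fin.Base using (Fin)
open import Data.Fin.Properties using (_≟_)
open import Data.Integer.Base as ℤ using (ℤ; 0ℤ; 1ℤ)
open import Data.Nat.Base using (ℕ)
open import Data.Product.Base using (Σ-syntax; _×_)
open import Data.Vec.Base using (Vec; lookup; tabulate)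
open import Function.Definitions using (Injective)
open import Level using (Level; 0ℓ; _⊔_)
open import Relation.Binary.PropositionalEquality.Core using (_≡_)
open import Relation.Nullary.Decidable.Core using (does)
open import Relation.Unary using (Pred)

private
  variable
    a p : Level

-- Vectors of rows, rather than functions Fin n → Fin n → ℤ, so that _≡_ is
-- entrywise equality without function extensionality.
M : ℕ → Set
M n = Vec (Vec ℤ n) n

entry : ∀ {n} → M n → Fin n → Fin n → ℤ
entry A i j = lookup (lookup A i) j

matrix : ∀ {n} → (Fin n → Fin n → ℤ) → M n
matrix f = tabulate λ i → tabulate λ j → f i j

open SemiringDefinitions ℤ.+-*-rawSemiring using () renaming (sum to ∑)

M-rawRing : ℕ → RawRing 0ℓ 0ℓ
M-rawRing n = record
  { Carrier = M n
  ; _≈_     = _≡_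
  ; _+_     = λ A B → matrix λ i j → entry A i j ℤ.+ entry B i j
  ; _*_     = λ A B → matrix λ i j → ∑ λ k → entry A i k ℤ.* entry B k j
  ; -_      = λ A → matrix λ i j → ℤ.- entry A i j
  ; 0#      = matrix λ i j → 0ℤ
  ; 1#      = matrix λ i j → if does (i ≟ j) then 1ℤ else 0ℤ
  }

-- The k-fold sum k · A = A + … + A is renamed from _×_, which clashes with
-- the product of types.
module _ {n : ℕ} where
  open RawRing (M-rawRing n) public using (_+_; _*_)
  open SemiringDefinitions (RawRing.rawSemiring (M-rawRing n)) public
    using (_^_) renaming (_×_ to infixr 8 _·_)

-- The subset P of A is infinite: there is a sequence of pairwise distinct
-- elements of A, all lying in P.  Distinctness is required in A itself, so
-- different proofs of membership do not count as different elements.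
Infinite : {A : Set a} → Pred A p → Set (a ⊔ p)
Infinite {A = A} P =
  Σ[ f ∈ (ℕ → A) ] Injective _≡_ _≡_ f × (∀ n → P (f n))

-- If X² = a I, Y² = b I and Z² = c I, the equation becomes a² + b² = 2c²,
-- solved by 1² + 7² = 2 · 5².  The involutions X with rows (1 , t) and (0 , -1)
-- give infinitely many square roots of I.
module Submission where

open import Defs
open import Data.Integer.Base as ℤ using (ℤ; +_; 0ℤ; 1ℤ; -1ℤ)
open import Data.Integer.Properties using (+-injective)
open import Data.Integer.Tactic.RingSolver using (solve-∀)
open import Data.Product.Base using (_×_; _,_)
open import Data.Fin.Patterns using (0F; 1F)
open import Data.Vec.Base using ([]; _∷_)
open import Function.Base using (_∘_)
open import Relation.Binary.PropositionalEquality.Core using (_≡_; refl; cong)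
open import Relation.Binary.PropositionalEquality.Properties using (module ≡-Reasoning)

-- A 2×2 matrix of trace 0 squares to minus its determinant times `I` (Cayley-Hamilton). So `X`,
-- `Y`, `Z` square to 1, 7, 5 times `I`, and 1 + 49 = 2 · 25; only `X` varies, through its free
-- corner entry.

⟦_,_⨾_,_⟧ : ℤ → ℤ → ℤ → ℤ → M 2
⟦ a , b ⨾ c , d ⟧ = (a ∷ b ∷ []) ∷ (c ∷ d ∷ []) ∷ []

matrix-≡ : ∀ {a b c d a′ b′ c′ d′} → a ≡ a′ → b ≡ b′ → c ≡ c′ → d ≡ d′ →
           ⟦ a , b ⨾ c , d ⟧ ≡ ⟦ a′ , b′ ⨾ c′ , d′ ⟧
matrix-≡ refl refl refl refl = refl

involution : ℤ → M 2
involution t = ⟦ 1ℤ , t ⨾ 0ℤ , -1ℤ ⟧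

I : M 2
I = ⟦ 1ℤ , 0ℤ ⨾ 0ℤ , 1ℤ ⟧

1+[t*0+0]≡1 : ∀ t → 1ℤ ℤ.+ (t ℤ.* 0ℤ ℤ.+ 0ℤ) ≡ 1ℤ
1+[t*0+0]≡1 = solve-∀

-- Each power unfolds to a product ending in `I`; this unit law does not hold by computation, as `t`
-- is a variable.
involution-*-I : ∀ t → involution t * I ≡ involution t
involution-*-I t = matrix-≡ (1+[t*0+0]≡1 t) (e₀₁ t) refl refl
  where
  e₀₁ : ∀ t → 0ℤ ℤ.+ (t ℤ.* 1ℤ ℤ.+ 0ℤ) ≡ t
  e₀₁ = solve-∀

involution-square : ∀ t → involution t * involution t ≡ I
involution-square t = matrix-≡ (1+[t*0+0]≡1 t) (e₀₁ t) refl refl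
  where
  e₀₁ : ∀ t → 1ℤ ℤ.* t ℤ.+ (t ℤ.* -1ℤ ℤ.+ 0ℤ) ≡ 0ℤ
  e₀₁ = solve-∀

involution-^4 : ∀ t → involution t ^ 4 ≡ I
involution-^4 t = begin
  X * (X * (X * (X * I)))  ≡⟨ cong (λ A → X * (X * (X * A))) (involution-*-I t) ⟩
  X * (X * (X * X))        ≡⟨ cong (λ A → X * (X * A)) (involution-square t) ⟩
  X * (X * I)              ≡⟨ cong (X *_) (involution-*-I t) ⟩
  X * X                    ≡⟨ involution-square t ⟩
  I                        ∎
  where
  open ≡-Reasoning
  X = involution t

theorem2p7 : Infinite {A = M 2 × M 2 × M 2} (λ (X , Y , Z) → X ^ 4 + Y ^ 4 ≡ 2 · Z ^ 4)
theorem2p7 =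
  (λ n → involution (+ n) , Y , Z) ,
  (+-injective ∘ cong (λ (X , _) → entry X 0F 1F)) ,
  -- Once `X ^ 4` is `I`, both sides are closed and evaluate to 50 times `I`.
  (λ n → cong (_+ Y ^ 4) (involution-^4 (+ n)))
  where
  Y Z : M 2
  -- Companion matrices of x² - 7 and x² - 5.
  Y = ⟦ 0ℤ , + 7 ⨾ 1ℤ , 0ℤ ⟧
  Z = ⟦ 0ℤ , + 5 ⨾ 1ℤ , 0ℤ ⟧
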